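{- Let $M$ be a set and let $\in_1,\in_2$ be binary relations on $M$ such that $(M,\in_1,\in_2)\models ZFC(\in_1)\cup ZFC(\in_2)$. Then $(M,\in_1)\cong(M,\in_2)$, and there is such an isomorphism which is a class function definable in $(M,\in_1,\in_2)$ by a first-order formula of the vocabulary $\{\in_1,\in_2\}$.
   Context: $ZFC(\in_1)$ denotes the first-order Zermelo–Fraenkel axioms of set theory with choice in which $\in_1$ plays the role of the membership relation, but where the formulas allowed in the axiom schemas (Separation and Replacement) may be arbitrary first-order formulas of the extended vocabulary $\{\in_1,\in_2\}$ (with parameters). $ZFC(\in_2)$ is defined symmetrically, with $\in_2$ as the membership relation and formulas again allowed to contain both $\in_1$ and $\in_2$. -}

module Defs where

open import Data.Nat using (ℕ; suc)
open import Data.Fin using (Fin; zero)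
open import Data.Vec using (Vec; []; _∷_; lookup)
open import Data.Product using (Σ; _×_; _,_)
open import Data.Sum using (_⊎_)
open import Data.Empty using (⊥)
open import Relation.Nullary using (¬_)
open import Relation.Binary.PropositionalEquality using (_≡_; _≢_)
open import Function.Bundles using (_⇔_)
open import Function.Definitions using (Bijective)

-- First-order logic over the vocabulary {∈₁, ∈₂} (with equality).
-- Formulas with n free variables, de Bruijn style (variable 0 is the
-- most recently bound / first entry of the assignment).

data Sym : Set where
  e₁ e₂ : Sym

data Formula (n : ℕ) : Set where
  _∈[_]_ : Fin n → Sym → Fin n → Formula n
  _≐_    : Fin n → Fin n → Formula n
  ⊥'     : Formula n
  ¬'_    : Formula n → Formula n
  _∧'_   : Formula n → Formula n → Formula n
  _∨'_   : Formula n → Formula n → Formula n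
  _⇒'_   : Formula n → Formula n → Formula n
  ∀'_    : Formula (suc n) → Formula n
  ∃'_    : Formula (suc n) → Formula n

record Structure : Set₁ where
  field
    M  : Set
    R₁ : M → M → Set
    R₂ : M → M → Set

  rel : Sym → M → M → Set
  rel e₁ = R₁
  rel e₂ = R₂

  Sat : ∀ {n} → Vec M n → Formula n → Set
  Sat ρ (i ∈[ s ] j) = rel s (lookup ρ i) (lookup ρ j)
  Sat ρ (i ≐ j)      = lookup ρ i ≡ lookup ρ j
  Sat ρ ⊥'           = ⊥
  Sat ρ (¬' φ)       = ¬ Sat ρ φ
  Sat ρ (φ ∧' ψ)     = Sat ρ φ × Sat ρ ψ
  Sat ρ (φ ∨' ψ)     = Sat ρ φ ⊎ Sat ρ ψ
  Sat ρ (φ ⇒' ψ)     = Sat ρ φ → Sat ρ ψ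
  Sat ρ (∀' φ)       = (x : M) → Sat (x ∷ ρ) φ
  Sat ρ (∃' φ)       = Σ M λ x → Sat (x ∷ ρ) φ

  -- The axioms of ZFC(∈ₛ), where the schemas range over all formulas of
  -- the full vocabulary {∈₁, ∈₂}, with arbitrary parameters.
  -- (Each axiom is written out as the unfolding of its satisfaction.)

  module _ (s : Sym) where
    private
      _∈_ : M → M → Set
      x ∈ y = rel s x y

    Extensionality : Set
    Extensionality = (x y : M) → ((z : M) → (z ∈ x) ⇔ (z ∈ y)) → x ≡ y

    Foundation : Set
    Foundation = (x : M) → Σ M (λ y → y ∈ x) →
                 Σ M λ y → y ∈ x × ¬ Σ M (λ z → z ∈ y × z ∈ x)

    Pairing : Set
    Pairing = (a b : M) → Σ M λ c → a ∈ c × b ∈ c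

    Union : Set
    Union = (F : M) → Σ M λ A → (Y x : M) → x ∈ Y → Y ∈ F → x ∈ A

    PowerSet : Set
    PowerSet = (x : M) → Σ M λ y → (z : M) → ((w : M) → w ∈ z → w ∈ x) → z ∈ y

    Infinity : Set
    Infinity = Σ M λ X →
                 Σ M (λ e → e ∈ X × ((w : M) → ¬ w ∈ e)) ×
                 ((y : M) → y ∈ X →
                    Σ M λ t → t ∈ X × ((w : M) → (w ∈ t) ⇔ (w ∈ y ⊎ w ≡ y)))

    Separation : Set
    Separation = (k : ℕ) (φ : Formula (suc k)) (ps : Vec M k) (a : M) →
                 Σ M λ b → (x : M) → (x ∈ b) ⇔ (x ∈ a × Sat (x ∷ ps) φ)

    Replacement : Set
    Replacement = (k : ℕ) (φ : Formula (suc (suc k))) (ps : Vec M k) (a : M) →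
                  ((x : M) → x ∈ a →
                     Σ M λ y → Sat (y ∷ x ∷ ps) φ ×
                       ((y' : M) → Sat (y' ∷ x ∷ ps) φ → y' ≡ y)) →
                  Σ M λ b → (x : M) → x ∈ a →
                     Σ M λ y → y ∈ b × Sat (y ∷ x ∷ ps) φ

    Choice : Set
    Choice = (F : M) →
             ((x : M) → x ∈ F → Σ M λ z → z ∈ x) →
             ((x y : M) → x ∈ F → y ∈ F → x ≢ y → ¬ Σ M (λ z → z ∈ x × z ∈ y)) →
             Σ M λ C → (x : M) → x ∈ F →
               Σ M λ z → (z ∈ x × z ∈ C) ×
                 ((z' : M) → z' ∈ x × z' ∈ C → z' ≡ z)

    record ZFC : Set where
      field
        extensionality : Extensionality
        foundation     : Foundation
        pairing        : Pairing
        union          : Union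
        powerSet       : PowerSet
        infinity       : Infinity
        separation     : Separation
        replacement    : Replacement
        choice         : Choice

  IsIso₁₂ : (M → M) → Set
  IsIso₁₂ f = Bijective _≡_ _≡_ f × ((x y : M) → R₁ x y ⇔ R₂ (f x) (f y))

  -- The class function f is defined by the formula φ(x, y)
  -- (x = variable 1, y = variable 0), without parameters.
  Defines : Formula 2 → (M → M) → Set
  Defines φ f = (x y : M) → Sat (y ∷ x ∷ []) φ ⇔ (f x ≡ y)

{-# OPTIONS --safe #-}

-- Let x ~ y mean that some ∈₁-set of pairs is a bisimulation between ∈₁ and ∈₂
-- relating x to y.  Then x ~ y holds iff every ∈₁-element of x is ~-related to an
-- ∈₂-element of y and vice versa, so by extensionality and ∈-induction ~ is an
-- isomorphism between an ∈₁-transitive class A and an ∈₂-transitive class B.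
--
-- If B is not everything, take y ⊆ B with y ∉ B.  Since ~ respects the comparison
-- of ranks, a member of B of larger rank than all members of y would bound the rank
-- of the preimage of y; that preimage would then be an ∈₁-set x with x ~ y.  So the
-- ranks in B are bounded and B is an ∈₂-set; symmetrically, A is everything or an
-- ∈₁-set.  If both are sets then A ~ B, whence A ∈₁ A.  If exactly one is a set,
-- Replacement along ~ turns the universe into a set.
module Submission where

open import Defs
open import Level using (0ℓ)
open import Data.Product using (Σ; _×_; _,_; proj₁; proj₂; swap)
open import Axiom.ExcludedMiddle using (ExcludedMiddle)
open import Data.Nat using (ℕ; suc)
open import Data.Fin using (Fin; zero; suc)
open import Data.Vec using (Vec; []; _∷_; lookup; map)
open import Data.Vec.Properties using (lookup-map)
open import Data.Sum using (_⊎_; inj₁; inj₂; reduce)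
open import Data.Empty using (⊥-elim)
open import Data.Product.Function.NonDependent.Propositional using (_×-⇔_)
open import Data.Sum.Function.Propositional using (_⊎-⇔_)
open import Function.Base using (flip)
open import Function.Bundles using (_⇔_; mk⇔; Equivalence)
open import Function.Properties.Equivalence using (⇔-isEquivalence)
open import Function.Related.TypeIsomorphisms using (→-cong-⇔; ¬-cong-⇔)
open import Relation.Binary.PropositionalEquality using (_≡_; refl; sym; trans; subst; subst₂)
open import Relation.Binary.Structures using (IsEquivalence)
open import Relation.Nullary using (¬_; yes; no)
open import Relation.Nullary.Decidable using (decidable-stable)

open Equivalence using (to; from)
open IsEquivalence (⇔-isEquivalence {0ℓ}) using () renaming (refl to ⇔-refl; trans to ⇔-trans)

pattern v0 = zero
pattern v1 = suc v0
pattern v2 = suc v1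
pattern v3 = suc v2
pattern v4 = suc v3

-- Congruence of logical equivalence, and renaming of variables

Π-cong-⇔ : {A : Set} {P Q : A → Set} → (∀ x → P x ⇔ Q x) → (∀ x → P x) ⇔ (∀ x → Q x)
Π-cong-⇔ e = mk⇔ (λ p x → to (e x) (p x)) (λ q x → from (e x) (q x))

Σ-cong-⇔ : {A : Set} {P Q : A → Set} → (∀ x → P x ⇔ Q x) → Σ A P ⇔ Σ A Q
Σ-cong-⇔ e = mk⇔ (λ (x , p) → x , to (e x) p) (λ (x , q) → x , from (e x) q)

⇔-cong-⇔ : {A B C D : Set} → A ⇔ B → C ⇔ D → ((A → C) × (C → A)) ⇔ (B ⇔ D)
⇔-cong-⇔ e e′ = mk⇔
  (λ (f , g) → mk⇔ (λ b → to e′ (f (from e b))) (λ d → to e (g (from e′ d))))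
  (λ h → (λ a → from e′ (to h (to e a))) , (λ c → from e (from h (to e′ c))))

lift : ∀ {m n} → (Fin m → Fin n) → Fin (suc m) → Fin (suc n)
lift f zero    = zero
lift f (suc i) = suc (f i)

rename : ∀ {m n} → (Fin m → Fin n) → Formula m → Formula n
rename f (i ∈[ s ] j) = f i ∈[ s ] f j
rename f (i ≐ j)      = f i ≐ f j
rename f ⊥'           = ⊥'
rename f (¬' φ)       = ¬' rename f φ
rename f (φ ∧' ψ)     = rename f φ ∧' rename f ψ
rename f (φ ∨' ψ)     = rename f φ ∨' rename f ψ
rename f (φ ⇒' ψ)     = rename f φ ⇒' rename f ψ
rename f (∀' φ)       = ∀' rename (lift f) φ
rename f (∃' φ)       = ∃' rename (lift f) φ

-- Definable relations and formulas built over them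

module Definability (𝔐 : Structure) where
  open Structure 𝔐

  Sat-rename : ∀ {m n} (f : Fin m → Fin n) (ρ : Vec M n) (σ : Vec M m) →
               (∀ i → lookup ρ (f i) ≡ lookup σ i) →
               ∀ φ → Sat ρ (rename f φ) ⇔ Sat σ φ
  Sat-rename f ρ σ e (i ∈[ s ] j) =
    mk⇔ (subst₂ (rel s) (e i) (e j)) (subst₂ (rel s) (sym (e i)) (sym (e j)))
  Sat-rename f ρ σ e (i ≐ j) =
    mk⇔ (subst₂ _≡_ (e i) (e j)) (subst₂ _≡_ (sym (e i)) (sym (e j)))
  Sat-rename f ρ σ e ⊥'       = ⇔-refl
  Sat-rename f ρ σ e (¬' φ)   = ¬-cong-⇔ (Sat-rename f ρ σ e φ)
  Sat-rename f ρ σ e (φ ∧' ψ) = Sat-rename f ρ σ e φ ×-⇔ Sat-rename f ρ σ e ψ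
  Sat-rename f ρ σ e (φ ∨' ψ) = Sat-rename f ρ σ e φ ⊎-⇔ Sat-rename f ρ σ e ψ
  Sat-rename f ρ σ e (φ ⇒' ψ) = →-cong-⇔ (Sat-rename f ρ σ e φ) (Sat-rename f ρ σ e ψ)
  Sat-rename f ρ σ e (∀' φ)   = Π-cong-⇔ λ x →
    Sat-rename (lift f) (x ∷ ρ) (x ∷ σ) (λ { zero → refl ; (suc i) → e i }) φ
  Sat-rename f ρ σ e (∃' φ)   = Σ-cong-⇔ λ x →
    Sat-rename (lift f) (x ∷ ρ) (x ∷ σ) (λ { zero → refl ; (suc i) → e i }) φ

  -- No parameters are allowed, as the final isomorphism must be defined without them; parameters
  -- enter only when a schema is applied.
  Definable : ∀ {k} → (Vec M k → Set) → Set
  Definable {k} Q = Σ (Formula k) λ φ → ∀ ρ → Sat ρ φ ⇔ Q ρ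

  uncurry₂ : (M → M → Set) → Vec M 2 → Set
  uncurry₂ Q (x ∷ y ∷ []) = Q x y

  uncurry₃ : (M → M → M → Set) → Vec M 3 → Set
  uncurry₃ Q (x ∷ y ∷ z ∷ []) = Q x y z

  Definable₂ : (M → M → Set) → Set
  Definable₂ Q = Definable (uncurry₂ Q)

  Definable₃ : (M → M → M → Set) → Set
  Definable₃ Q = Definable (uncurry₃ Q)

  infix  8 all_ ex_ ∼_
  infixr 7 _&_
  infixr 6 _∥_
  infixr 5 _⟶_
  infix  4 _⟷_

  -- Formulas in which every definable relation may occur as an atom;
  -- ⟦_⟧ unfolds such an atom to the relation itself, not to its definition.
  data Fm (n : ℕ) : Set₁ where
    pred : ∀ {k} {Q : Vec M k → Set} → Definable Q → Vec (Fin n) k → Fm n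
    ∼_   : Fm n → Fm n
    _&_ _∥_ _⟶_ _⟷_ : Fm n → Fm n → Fm n
    all_ ex_ : Fm (suc n) → Fm n

  ⟦_⟧ : ∀ {n} → Fm n → Vec M n → Set
  ⟦ pred {Q = Q} _ is ⟧ ρ = Q (map (lookup ρ) is)
  ⟦ ∼ φ ⟧     ρ = ¬ ⟦ φ ⟧ ρ
  ⟦ φ & ψ ⟧   ρ = ⟦ φ ⟧ ρ × ⟦ ψ ⟧ ρ
  ⟦ φ ∥ ψ ⟧   ρ = ⟦ φ ⟧ ρ ⊎ ⟦ ψ ⟧ ρ
  ⟦ φ ⟶ ψ ⟧   ρ = ⟦ φ ⟧ ρ → ⟦ ψ ⟧ ρ
  ⟦ φ ⟷ ψ ⟧   ρ = ⟦ φ ⟧ ρ ⇔ ⟦ ψ ⟧ ρ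
  ⟦ all φ ⟧   ρ = ∀ x → ⟦ φ ⟧ (x ∷ ρ)
  ⟦ ex φ ⟧    ρ = Σ M λ x → ⟦ φ ⟧ (x ∷ ρ)

  unfold : ∀ {n} → Fm n → Formula n
  unfold (pred (φ , _) is) = rename (lookup is) φ
  unfold (∼ φ)   = ¬' unfold φ
  unfold (φ & ψ) = unfold φ ∧' unfold ψ
  unfold (φ ∥ ψ) = unfold φ ∨' unfold ψ
  unfold (φ ⟶ ψ) = unfold φ ⇒' unfold ψ
  unfold (φ ⟷ ψ) = (unfold φ ⇒' unfold ψ) ∧' (unfold ψ ⇒' unfold φ)
  unfold (all φ) = ∀' unfold φ
  unfold (ex φ)  = ∃' unfold φ

  Sat-unfold : ∀ {n} (φ : Fm n) ρ → Sat ρ (unfold φ) ⇔ ⟦ φ ⟧ ρ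
  Sat-unfold (pred (φ , h) is) ρ =
    ⇔-trans (Sat-rename (lookup is) ρ (map (lookup ρ) is)
                        (λ i → sym (lookup-map i (lookup ρ) is)) φ)
            (h _)
  Sat-unfold (∼ φ)   ρ = ¬-cong-⇔ (Sat-unfold φ ρ)
  Sat-unfold (φ & ψ) ρ = Sat-unfold φ ρ ×-⇔ Sat-unfold ψ ρ
  Sat-unfold (φ ∥ ψ) ρ = Sat-unfold φ ρ ⊎-⇔ Sat-unfold ψ ρ
  Sat-unfold (φ ⟶ ψ) ρ = →-cong-⇔ (Sat-unfold φ ρ) (Sat-unfold ψ ρ)
  Sat-unfold (φ ⟷ ψ) ρ = ⇔-cong-⇔ (Sat-unfold φ ρ) (Sat-unfold ψ ρ)
  Sat-unfold (all φ) ρ = Π-cong-⇔ λ x → Sat-unfold φ (x ∷ ρ)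
  Sat-unfold (ex φ)  ρ = Σ-cong-⇔ λ x → Sat-unfold φ (x ∷ ρ)

  atom : ∀ {n Q} → Definable₂ Q → Fin n → Fin n → Fm n
  atom d i j = pred d (i ∷ j ∷ [])

  atom₃ : ∀ {n Q} → Definable₃ Q → Fin n → Fin n → Fin n → Fm n
  atom₃ d i j k = pred d (i ∷ j ∷ k ∷ [])

  definable₂ : (φ : Fm 2) → Definable₂ (λ x y → ⟦ φ ⟧ (x ∷ y ∷ []))
  definable₂ φ = unfold φ , λ { (x ∷ y ∷ []) → Sat-unfold φ (x ∷ y ∷ []) }

  definable₃ : (φ : Fm 3) → Definable₃ (λ x y z → ⟦ φ ⟧ (x ∷ y ∷ z ∷ []))
  definable₃ φ = unfold φ , λ { (x ∷ y ∷ z ∷ []) → Sat-unfold φ (x ∷ y ∷ z ∷ []) }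

  rel-definable : ∀ s → Definable₂ (rel s)
  rel-definable s = (v0 ∈[ s ] v1) , λ { (x ∷ y ∷ []) → ⇔-refl }

  ≡-definable : Definable₂ _≡_
  ≡-definable = (v0 ≐ v1) , λ { (x ∷ y ∷ []) → ⇔-refl }

  opaque
    flip-definable : ∀ {Q} → Definable₂ Q → Definable₂ (flip Q)
    flip-definable d = definable₂ (atom d v1 v0)

  infix 9 _∈⟨_⟩_ _≈_

  _∈⟨_⟩_ : ∀ {n} → Fin n → Sym → Fin n → Fm n
  i ∈⟨ s ⟩ j = atom (rel-definable s) i j

  _≈_ : ∀ {n} → Fin n → Fin n → Fm n
  i ≈ j = atom ≡-definable i j

-- Set theory inside a single membership relation

module OneMembership (em : ExcludedMiddle 0ℓ) (𝔐 : Structure) (s : Sym)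
                     (zfc : Structure.ZFC 𝔐 s) where
  open Structure 𝔐
  open Definability 𝔐
  open ZFC zfc

  infix 4 _∈_ _≼_
  infix 9 _ε_

  _∈_ : M → M → Set
  _∈_ = rel s

  _ε_ : ∀ {n} → Fin n → Fin n → Fm n
  i ε j = i ∈⟨ s ⟩ j

  same-elements : ∀ {P : M → Set} {x y} → (∀ z → z ∈ x ⇔ P z) → (∀ z → z ∈ y ⇔ P z) → x ≡ y
  same-elements h k = extensionality _ _ λ z →
    mk⇔ (λ i → from (k z) (to (h z) i)) (λ i → from (h z) (to (k z) i))

  opaque
    separate : ∀ {k} (φ : Fm (suc k)) (ps : Vec M k) a →
               Σ M λ b → ∀ x → x ∈ b ⇔ (x ∈ a × ⟦ φ ⟧ (x ∷ ps))
    separate φ ps a =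
      let b , h = separation _ (unfold φ) ps a
      in b , λ x → ⇔-trans (h x) (⇔-refl ×-⇔ Sat-unfold φ (x ∷ ps))

    comprehend : ∀ {k} (φ : Fm (suc k)) (ps : Vec M k) a →
                 (∀ x → ⟦ φ ⟧ (x ∷ ps) → x ∈ a) →
                 Σ M λ b → ∀ x → x ∈ b ⇔ ⟦ φ ⟧ (x ∷ ps)
    comprehend φ ps a bound =
      let b , h = separate φ ps a
      in b , λ x → mk⇔ (λ x∈b → proj₂ (to (h x) x∈b)) (λ p → from (h x) (bound x p , p))

  Functional : ∀ {k} → Fm (suc (suc k)) → Vec M k → Set
  Functional φ ps = ∀ x y y′ → ⟦ φ ⟧ (y ∷ x ∷ ps) → ⟦ φ ⟧ (y′ ∷ x ∷ ps) → y ≡ y′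

  opaque
    image : ∀ {k} (φ : Fm (suc (suc k))) (ps : Vec M k) → Functional φ ps → ∀ a →
            Σ M λ b → ∀ x y → x ∈ a → ⟦ φ ⟧ (y ∷ x ∷ ps) → y ∈ b
    image φ ps fun a =
      -- Replacement asks for a value at every member, so `a` is first cut down to the members where
      -- `φ` has one.
      let a′ , h = separate (ex φ) ps a
          b , k = replacement _ (unfold φ) ps a′ λ x x∈a′ →
            let y , p = proj₂ (to (h x) x∈a′)
            in y , from (Sat-unfold φ _) p , λ y′ p′ → fun x y′ y (to (Sat-unfold φ _) p′) p
      in b , λ x y x∈a p →
        let y′ , y′∈b , p′ = k x (from (h x) (x∈a , y , p))
        in subst (_∈ b) (fun x y′ y (to (Sat-unfold φ _) p′) p) y′∈b

    image-union : ∀ {k} (φ : Fm (suc (suc k))) (ps : Vec M k) → Functional φ ps → ∀ a →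
                  Σ M λ c → ∀ x y z → x ∈ a → ⟦ φ ⟧ (y ∷ x ∷ ps) → z ∈ y → z ∈ c
    image-union φ ps fun a =
      let b , h = image φ ps fun a
          c , k = union b
      in c , λ x y z x∈a p z∈y → k y z z∈y (h x y x∈a p)

    ∪-bound : ∀ a b → Σ M λ c → ∀ z → z ∈ a ⊎ z ∈ b → z ∈ c
    ∪-bound a b =
      let d , a∈d , b∈d = pairing a b
          c , h = union d
      in c , λ z → λ { (inj₁ z∈a) → h a z z∈a a∈d ; (inj₂ z∈b) → h b z z∈b b∈d }

    ∅ : Σ M λ e → ∀ z → ¬ z ∈ e
    ∅ = let _ , (e , _ , h) , _ = infinity in e , h

  -- Russell's paradox.
  no-universal-set : ∀ c → ¬ (∀ x → x ∈ c)
  no-universal-set c h =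
    let r , k = comprehend (∼ (v0 ε v0)) [] c (λ x _ → h x)
        r∉r = λ r∈r → to (k r) r∈r r∈r
    in r∉r (from (k r) r∉r)

  -- Kuratowski pairs and the relations they code

  IsUnordered : M → M → M → Set
  IsUnordered q a b = ∀ z → z ∈ q ⇔ (z ≡ a ⊎ z ≡ b)

  IsPair : M → M → M → Set
  IsPair p a b = ∀ q → q ∈ p ⇔ (IsUnordered q a a ⊎ IsUnordered q a b)

  -- Members of `R` that are not pairs are ignored, so every element of `M` codes a relation.
  Edge : M → M → M → Set
  Edge R u v = Σ M λ p → IsPair p u v × p ∈ R

  opaque
    IsUnordered-definable : Definable₃ IsUnordered
    IsUnordered-definable = definable₃ (all (v0 ε v1 ⟷ v0 ≈ v2 ∥ v0 ≈ v3))

  isUnordered : ∀ {n} → Fin n → Fin n → Fin n → Fm n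
  isUnordered = atom₃ IsUnordered-definable

  opaque
    IsPair-definable : Definable₃ IsPair
    IsPair-definable = definable₃ (all (v0 ε v1 ⟷ isUnordered v0 v2 v2 ∥ isUnordered v0 v2 v3))

  isPair : ∀ {n} → Fin n → Fin n → Fin n → Fm n
  isPair = atom₃ IsPair-definable

  opaque
    Edge-definable : Definable₃ Edge
    Edge-definable = definable₃ (ex (isPair v0 v2 v3 & v0 ε v1))

  edge : ∀ {n} → Fin n → Fin n → Fin n → Fm n
  edge = atom₃ Edge-definable

  opaque
    unordered : ∀ a b → Σ M λ q → IsUnordered q a b
    unordered a b =
      let c , a∈c , b∈c = pairing a b
      in comprehend (v0 ≈ v1 ∥ v0 ≈ v2) (a ∷ b ∷ []) c
           λ { _ (inj₁ refl) → a∈c ; _ (inj₂ refl) → b∈c }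

  IsUnordered-unique : ∀ {q q′ a b} → IsUnordered q a b → IsUnordered q′ a b → q ≡ q′
  IsUnordered-unique = same-elements

  opaque
    pair : ∀ a b → Σ M λ p → IsPair p a b
    pair a b =
      let q , h = unordered a a
          r , k = unordered a b
          c , q∈c , r∈c = pairing q r
      in comprehend (isUnordered v0 v1 v1 ∥ isUnordered v0 v1 v2) (a ∷ b ∷ []) c
           λ { x (inj₁ i) → subst (_∈ c) (IsUnordered-unique h i) q∈c
             ; x (inj₂ i) → subst (_∈ c) (IsUnordered-unique k i) r∈c }

  -- The singleton of `a` is a member of `p`, and every member of `p` contains `a′`.
  IsPair-fst : ∀ {p a b a′ b′} → IsPair p a b → IsPair p a′ b′ → a ≡ a′
  IsPair-fst {a = a} {a′ = a′} h h′ with q , k ← unordered a a =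
    sym (reduce (to (k a′) (member (to (h′ q) (from (h q) (inj₁ k))))))
    where
    member : ∀ {q b′} → IsUnordered q a′ a′ ⊎ IsUnordered q a′ b′ → a′ ∈ q
    member (inj₁ u) = from (u a′) (inj₁ refl)
    member (inj₂ u) = from (u a′) (inj₁ refl)

  -- The alternative `b ≡ a` is the degenerate case where the unordered pair collapses to a
  -- singleton; `IsPair-snd` removes it by using both directions.
  IsPair-snd′ : ∀ {p a b b′} → IsPair p a b → IsPair p a b′ → b ≡ a ⊎ b ≡ b′
  IsPair-snd′ {a = a} {b} h h′ with unordered a b
  ... | q , k with to (h′ q) (from (h q) (inj₂ k))
  ...   | inj₂ u = to (u b) (from (k b) (inj₂ refl))
  ...   | inj₁ u = inj₁ (reduce (to (u b) (from (k b) (inj₂ refl))))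

  IsPair-snd : ∀ {p a b b′} → IsPair p a b → IsPair p a b′ → b ≡ b′
  IsPair-snd h h′ with IsPair-snd′ h h′ | IsPair-snd′ h′ h
  ... | inj₂ e | _      = e
  ... | inj₁ _ | inj₂ e = sym e
  ... | inj₁ e | inj₁ e′ = trans e (sym e′)

  IsPair-injective : ∀ {p a b a′ b′} → IsPair p a b → IsPair p a′ b′ → a ≡ a′ × b ≡ b′
  IsPair-injective h h′ with IsPair-fst h h′
  ... | refl = refl , IsPair-snd h h′

  opaque
    add-edge : ∀ R u v → Σ M λ R′ → ∀ a b → Edge R′ a b ⇔ (Edge R a b ⊎ (a ≡ u × b ≡ v))
    add-edge R u v =
      let p , pr = pair u v
          q , k = unordered p p
          c , h = ∪-bound R q
          R′ , e = comprehend (v0 ε v1 ∥ v0 ≈ v2) (R ∷ p ∷ []) c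
            λ { x (inj₁ x∈R) → h x (inj₁ x∈R)
              ; x (inj₂ x≡p) → h x (inj₂ (from (k x) (inj₁ x≡p))) }
      in R′ , λ a b → mk⇔
           (λ (r , pr′ , r∈R′) → split pr pr′ (to (e r) r∈R′))
           λ { (inj₁ (r , pr′ , r∈R)) → r , pr′ , from (e r) (inj₁ r∈R)
             ; (inj₂ (refl , refl)) → p , pr , from (e p) (inj₂ refl) }
      where
      split : ∀ {p r a b} → IsPair p u v → IsPair r a b → r ∈ R ⊎ r ≡ p →
              Edge R a b ⊎ (a ≡ u × b ≡ v)
      split pr pr′ (inj₁ r∈R) = inj₁ (_ , pr′ , r∈R)
      split pr pr′ (inj₂ refl) = inj₂ (IsPair-injective pr′ pr)

    pairs-bound : ∀ X Y → Σ M λ c → ∀ p u v → u ∈ X → v ∈ Y → IsPair p u v → p ∈ c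
    pairs-bound X Y =
      let Z , h = ∪-bound X Y
          Z₁ , h₁ = powerSet Z
          Z₂ , h₂ = powerSet Z₁
      in Z₂ , λ p u v u∈X v∈Y pr → h₂ p λ q q∈p → h₁ q λ z z∈q →
           sub (h u (inj₁ u∈X)) (h v (inj₂ v∈Y)) (to (pr q) q∈p) z∈q
      where
      sub : ∀ {Z q u v z} → u ∈ Z → v ∈ Z → IsUnordered q u u ⊎ IsUnordered q u v → z ∈ q → z ∈ Z
      sub {z = z} i j (inj₁ k) z∈q with to (k z) z∈q
      ... | inj₁ refl = i
      ... | inj₂ refl = i
      sub {z = z} i j (inj₂ k) z∈q with to (k z) z∈q
      ... | inj₁ refl = i
      ... | inj₂ refl = j

    -- Here Separation for the full vocabulary matters: `Q` may mention both memberships, yet its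
    -- restriction to two sets is coded by a set of the one membership `s`.
    graph : ∀ {Q} → Definable₂ Q → ∀ X Y →
            Σ M λ R → ∀ u v → Edge R u v ⇔ (u ∈ X × v ∈ Y × Q u v)
    graph {Q} d X Y =
      let c , h = pairs-bound X Y
          R , e = comprehend
            (ex ex (isPair v2 v1 v0 & v1 ε v3 & v0 ε v4 & atom d v1 v0))
            (X ∷ Y ∷ []) c
            λ p (u , v , pr , u∈X , v∈Y , _) → h p u v u∈X v∈Y pr
      in R , λ u v → mk⇔
           (λ (p , pr , p∈R) → let u′ , v′ , pr′ , r = to (e p) p∈R
                               in transport (IsPair-injective pr′ pr) r)
           (λ r → let p , pr = pair u v in p , pr , from (e p) (u , v , pr , r))
      where
      transport : ∀ {u v u′ v′} → u′ ≡ u × v′ ≡ v →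
                  u′ ∈ X × v′ ∈ Y × Q u′ v′ → u ∈ X × v ∈ Y × Q u v
      transport (refl , refl) r = r

  -- Transitive closures and ∈-induction

  -- An edge from `k` to `w` is read as the claim that `w` lies in layer `k` over `x`; every claim
  -- in `G` must be justified by `x` or by a claim about a member of `k`.
  Closed : M → M → Set
  Closed x G = ∀ k w → Edge G k w →
    w ∈ x ⊎ Σ M λ j → j ∈ k × Σ M λ w′ → w ∈ w′ × Edge G j w′

  -- z ∈ Lₙ for the hierarchy Lₙ = x ∪ ⋃{⋃Lⱼ : j ∈ n}.
  Layer : M → M → M → Set
  Layer x n z = Σ M λ G → Closed x G × Edge G n z

  opaque
    Layer-definable : Definable₃ Layer
    Layer-definable = definable₃
      (ex (all all (edge v2 v1 v0 ⟶
                    v0 ε v3 ∥ ex (v0 ε v2 & ex (v2 ε v0 & edge v4 v1 v0))) &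
           edge v0 v2 v3))

  IsLayer : M → M → M → Set
  IsLayer x y n = ∀ z → z ∈ y ⇔ Layer x n z

  opaque
    IsLayer-definable : Definable₃ IsLayer
    IsLayer-definable = definable₃ (all (v0 ε v2 ⟷ atom₃ Layer-definable v1 v3 v0))

  module _ {x : M} where

    layer-out : ∀ {n z} → Layer x n z →
                z ∈ x ⊎ Σ M λ j → j ∈ n × Σ M λ w → z ∈ w × Layer x j w
    layer-out (G , h , g) with h _ _ g
    ... | inj₁ z∈x = inj₁ z∈x
    ... | inj₂ (j , j∈n , w , z∈w , g′) = inj₂ (j , j∈n , w , z∈w , G , h , g′)

    -- The converse of `layer-out`. A justification uses a single earlier claim, so enlarging one
    -- certificate by one edge suffices.
    extend : ∀ {G n z} → Closed x G →
             z ∈ x ⊎ (Σ M λ j → j ∈ n × Σ M λ w → z ∈ w × Edge G j w) → Layer x n z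
    extend {G} {n} {z} h st with G′ , e ← add-edge G n z =
      G′ , (λ k w g → closed (to (e k w) g)) , from (e n z) (inj₂ (refl , refl))
      where
      weaken : ∀ {k w} → w ∈ x ⊎ (Σ M λ j → j ∈ k × Σ M λ w′ → w ∈ w′ × Edge G j w′) →
               w ∈ x ⊎ (Σ M λ j → j ∈ k × Σ M λ w′ → w ∈ w′ × Edge G′ j w′)
      weaken (inj₁ w∈x) = inj₁ w∈x
      weaken (inj₂ (j , j∈k , w′ , w∈w′ , g)) = inj₂ (j , j∈k , w′ , w∈w′ , from (e j w′) (inj₁ g))

      closed : ∀ {k w} → Edge G k w ⊎ (k ≡ n × w ≡ z) →
               w ∈ x ⊎ (Σ M λ j → j ∈ k × Σ M λ w′ → w ∈ w′ × Edge G′ j w′)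
      closed (inj₁ g) = weaken (h _ _ g)
      closed (inj₂ (refl , refl)) = weaken st

    layer-base : ∀ {n z} → z ∈ x → Layer x n z
    layer-base {n} {z} z∈x =
      let e , h = ∅
      in extend (λ k w (p , _ , p∈e) → ⊥-elim (h p p∈e)) (inj₁ z∈x)

    layer-step : ∀ {n z j w} → j ∈ n → z ∈ w → Layer x j w → Layer x n z
    layer-step {n} {z} {j} {w} j∈n z∈w (G , h , g) =
      extend h (inj₂ (j , j∈n , w , z∈w , g))

    layer-zero : ∀ {e} → (∀ w → ¬ w ∈ e) → IsLayer x x e
    layer-zero h z = mk⇔ layer-base λ l → case (layer-out l)
      where
      case : _ → z ∈ x
      case (inj₁ z∈x) = z∈x
      case (inj₂ (j , j∈e , _)) = ⊥-elim (h j j∈e)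

    -- For `t` the successor of `n`, the recursion collapses to the union of layer `n` with the
    -- elements of its members: the indices in `n` contribute only what layer `n` already has.
    layer-suc : ∀ {n t} → (∀ w → w ∈ t ⇔ (w ∈ n ⊎ w ≡ n)) →
                Σ M (λ y → IsLayer x y n) → Σ M λ y → IsLayer x y t
    layer-suc {n} {t} ht (y , hy) =
      let U , hU = union y
          c , hc = ∪-bound y U
          y′ , hy′ = comprehend (v0 ε v1 ∥ ex (v1 ε v0 & v0 ε v2)) (y ∷ []) c
            λ { z (inj₁ z∈y) → hc z (inj₁ z∈y)
              ; z (inj₂ (w , z∈w , w∈y)) → hc z (inj₂ (hU w z z∈w w∈y)) }
      in y′ , λ z → mk⇔ (λ i → fwd (to (hy′ z) i))
                        (λ l → from (hy′ z) (bwd (layer-out l)))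
      where
      lift-layer : ∀ {z} → Layer x n z → Layer x t z
      lift-layer l with layer-out l
      ... | inj₁ z∈x = layer-base z∈x
      ... | inj₂ (j , j∈n , w , z∈w , l′) = layer-step (from (ht j) (inj₁ j∈n)) z∈w l′

      fwd : ∀ {z} → z ∈ y ⊎ (Σ M λ w → z ∈ w × w ∈ y) → Layer x t z
      fwd (inj₁ z∈y) = lift-layer (to (hy _) z∈y)
      fwd (inj₂ (w , z∈w , w∈y)) = layer-step (from (ht n) (inj₂ refl)) z∈w (to (hy w) w∈y)

      bwd : ∀ {z} → z ∈ x ⊎ (Σ M λ j → j ∈ t × Σ M λ w → z ∈ w × Layer x j w) →
            z ∈ y ⊎ (Σ M λ w → z ∈ w × w ∈ y)
      bwd (inj₁ z∈x) = inj₁ (from (hy _) (layer-base z∈x))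
      bwd (inj₂ (j , j∈t , w , z∈w , l)) with to (ht j) j∈t
      ... | inj₁ j∈n  = inj₁ (from (hy _) (layer-step j∈n z∈w l))
      ... | inj₂ refl = inj₂ (w , z∈w , from (hy w) l)

    layered-indices : ∀ X → Σ M λ N → ∀ n → n ∈ N ⇔ (n ∈ X × Σ M λ y → IsLayer x y n)
    layered-indices X = separate (ex (atom₃ IsLayer-definable v2 v0 v1)) (x ∷ []) X

    layers-union : ∀ N → (∀ n → n ∈ N → Σ M λ y → IsLayer x y n) →
                   Σ M λ T → ∀ z → z ∈ T ⇔ Σ M λ n → n ∈ N × Layer x n z
    layers-union N h
      with c , hc ← image-union (atom₃ IsLayer-definable v2 v0 v1) (x ∷ [])
             (λ _ _ _ → same-elements) N
      = comprehend (ex (v0 ε v2 & atom₃ Layer-definable v3 v0 v1)) (N ∷ x ∷ []) c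
          λ z (n , n∈N , l) → let y , hy = h n n∈N in hc n y z n∈N hy (from (hy z) l)

  opaque
    transitive-superset : ∀ x → Σ M λ T → (∀ z → z ∈ x → z ∈ T) × (∀ z w → z ∈ T → w ∈ z → w ∈ T)
    transitive-superset x
      with X , (e , e∈X , he) , hS ← infinity
      -- An inductive set may have members other than natural numbers. Keeping the indices whose
      -- layer is a set retains zero and is stable under successor, which is all that the union of
      -- the layers requires.
      with N , hN ← layered-indices {x} X
      with T , hT ← layers-union {x} N (λ n n∈N → proj₂ (to (hN n) n∈N))
      = T
      , (λ z z∈x → from (hT z) (e , from (hN e) (e∈X , x , layer-zero he) , layer-base z∈x))
      , λ z w z∈T w∈z →
          let n , n∈N , l = to (hT z) z∈T
              n∈X , y = to (hN n) n∈N
              t , t∈X , ht = hS n n∈X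
          in from (hT w) (t , from (hN t) (t∈X , layer-suc ht y)
                        , layer-step (from (ht n) (inj₂ refl)) w∈z l)

  -- Foundation gives minimal members of sets only. The counterexamples inside a transitive set
  -- around `x` form a set, and transitivity makes a minimal one minimal in the whole class. The
  -- formula may mention both memberships.
  ∈-induction : ∀ {k} (φ : Fm (suc k)) (ps : Vec M k) →
                (∀ x → (∀ u → u ∈ x → ⟦ φ ⟧ (u ∷ ps)) → ⟦ φ ⟧ (x ∷ ps)) →
                ∀ x → ⟦ φ ⟧ (x ∷ ps)
  ∈-induction φ ps step x = step x λ u u∈x → decidable-stable em (counterexample u u∈x)
    where
    counterexample : ∀ u → u ∈ x → ¬ ¬ ⟦ φ ⟧ (u ∷ ps)
    counterexample u u∈x ¬p =
      let T , x⊆T , T-trans = transitive-superset x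
          W , hW = separate (∼ φ) ps T
          m , m∈W , min = foundation W (u , from (hW u) (x⊆T u u∈x , ¬p))
          m∈T , ¬q = to (hW m) m∈W
      in ¬q (step m λ v v∈m → decidable-stable em λ ¬r →
               min (v , v∈m , from (hW v) (T-trans m v m∈T v∈m , ¬r)))

  ∈-irreflexive : ∀ x → ¬ x ∈ x
  ∈-irreflexive = ∈-induction (∼ (v0 ε v0)) [] λ x ih x∈x → ih x x∈x x∈x

  -- Comparison of ranks

  Simulates : (M → M → Set) → M → M → Set
  Simulates R x y = ∀ u → u ∈ x → Σ M λ v → v ∈ y × R u v

  -- rank x ≤ rank y, since rank is determined by
  -- rank x ≤ rank y ⇔ ∀ u ∈ x, ∃ v ∈ y, rank u ≤ rank v.
  _≼_ : M → M → Set
  x ≼ y = Σ M λ R → (∀ u v → Edge R u v → Simulates (Edge R) u v) × Simulates (Edge R) x y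

  opaque
    ≼-definable : Definable₂ _≼_
    ≼-definable = definable₂
      (ex (all all (edge v2 v1 v0 ⟶ all (v0 ε v2 ⟶ ex (v0 ε v2 & edge v4 v1 v0))) &
           all (v0 ε v2 ⟶ ex (v0 ε v4 & edge v2 v1 v0))))

  ≼-out : ∀ {x y} → x ≼ y → Simulates _≼_ x y
  ≼-out (R , h , st) u u∈x =
    let v , v∈y , g = st u u∈x in v , v∈y , R , h , h u v g

  -- Each element of `x` comes with its own witness, but one set is required. Restricting the class
  -- `≼` to transitive sets around `x` and `y` gives it, because `≼-out` never leaves them.
  ≼-in : ∀ {x y} → Simulates _≼_ x y → x ≼ y
  ≼-in {x} {y} st =
    let X , x⊆X , X-trans = transitive-superset x
        Y , y⊆Y , Y-trans = transitive-superset y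
        R , e = graph ≼-definable X Y
    in R ,
       (λ u v g u′ u′∈u →
         let u∈X , v∈Y , u≼v = to (e u v) g
             v′ , v′∈v , u′≼v′ = ≼-out u≼v u′ u′∈u
         in v′ , v′∈v , from (e u′ v′) (X-trans u u′ u∈X u′∈u , Y-trans v v′ v∈Y v′∈v , u′≼v′)) ,
       λ u u∈x → let v , v∈y , u≼v = st u u∈x
                 in v , v∈y , from (e u v) (x⊆X u u∈x , y⊆Y v v∈y , u≼v)

  opaque
    -- If some `u` in `x` is below no element of `y`, the induction hypothesis puts every element of
    -- `y` below `u`, so `y ≼ x`.
    ≼-total : ∀ x y → x ≼ y ⊎ y ≼ x
    ≼-total = ∈-induction (all (atom ≼-definable v1 v0 ∥ atom ≼-definable v0 v1)) [] step
      where
      step : ∀ x → (∀ u → u ∈ x → ∀ y → u ≼ y ⊎ y ≼ u) → ∀ y → x ≼ y ⊎ y ≼ x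
      step x ih y with em {Σ M λ u → u ∈ x × ¬ Σ M λ v → v ∈ y × u ≼ v}
      ... | yes (u , u∈x , h) = inj₂ (≼-in λ v v∈y → u , u∈x , below v v∈y)
        where
        below : ∀ v → v ∈ y → v ≼ u
        below v v∈y with ih u u∈x v
        ... | inj₁ u≼v = ⊥-elim (h (v , v∈y , u≼v))
        ... | inj₂ v≼u = v≼u
      ... | no h = inj₁ (≼-in above)
        where
        above : Simulates _≼_ x y
        above u u∈x with em {Σ M λ v → v ∈ y × u ≼ v}
        ... | yes p = p
        ... | no ¬p = ⊥-elim (h (u , u∈x , ¬p))

  isDownSet : ∀ {n} → Fin n → Fin n → Fm n
  isDownSet b x = all (v0 ε suc b ⟷ atom ≼-definable v0 (suc x))

  isDownSet-functional : Functional (isDownSet v0 v1) []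
  isDownSet-functional _ _ _ = same-elements

  opaque
    -- This is a level of the cumulative hierarchy. If `u ≼ x`, each element of `u` lies in the
    -- down-set of some element of `x`, so `u` is a subset of the union of these down-sets.
    downSet : ∀ x → Σ M λ b → ∀ u → u ∈ b ⇔ u ≼ x
    downSet = ∈-induction (ex (isDownSet v0 v1)) [] λ x ih →
      let c , h = image-union (isDownSet v0 v1) [] isDownSet-functional x
          P , k = powerSet c
      in comprehend (atom ≼-definable v0 v1) (x ∷ []) P λ u u≼x → k u λ u′ u′∈u →
           let v , v∈x , u′≼v = ≼-out u≼x u′ u′∈u
               b , hb = ih v v∈x
           in h v b u′ v∈x hb (from (hb u′) u′≼v)

    below-member-bound : ∀ y → Σ M λ c → ∀ u w → w ∈ y → u ≼ w → u ∈ c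
    below-member-bound y =
      let c , h = image-union (isDownSet v0 v1) [] isDownSet-functional y
      in c , λ u w w∈y u≼w → let b , hb = downSet w in h w b u w∈y hb (from (hb u) u≼w)

-- Bisimulations between two membership relations

module Bisimulation (em : ExcludedMiddle 0ℓ) (𝔐 : Structure) (s t : Sym)
                    (zfcₛ : Structure.ZFC 𝔐 s) (zfcₜ : Structure.ZFC 𝔐 t) where
  open Structure 𝔐
  open Definability 𝔐
  module S = OneMembership em 𝔐 s zfcₛ
  module T = OneMembership em 𝔐 t zfcₜ
  open S using () renaming (_∈_ to _∈ₛ_; _≼_ to _≼ₛ_)
  open T using () renaming (_∈_ to _∈ₜ_; _≼_ to _≼ₜ_)

  Bisimulates : (M → M → Set) → M → M → Set
  Bisimulates R x y =
    (∀ u → u ∈ₛ x → Σ M λ v → v ∈ₜ y × R u v) × (∀ v → v ∈ₜ y → Σ M λ u → u ∈ₛ x × R u v)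

  -- An element of `y` is matched with some `u` in `x`, and `u` with an element of `y′`; the
  -- induction hypothesis at `u` identifies the two, and extensionality for `t` finishes.
  functional : ∀ {R} → Definable₂ R → (∀ {x y} → R x y → Bisimulates R x y) →
               ∀ x y y′ → R x y → R x y′ → y ≡ y′
  functional {R} d out = S.∈-induction
    (all all (atom d v2 v1 ⟶ atom d v2 v0 ⟶ v1 ≈ v0)) []
    λ x ih y y′ r r′ → ZFC.extensionality zfcₜ y y′ λ z →
      mk⇔ (half x ih r r′ z) (half x ih r′ r z)
    where
    half : ∀ x → (∀ u → u ∈ₛ x → ∀ y y′ → R u y → R u y′ → y ≡ y′) →
           ∀ {y y′} → R x y → R x y′ → ∀ z → z ∈ₜ y → z ∈ₜ y′
    half x ih {y} {y′} r r′ z z∈y =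
      let u , u∈x , p = proj₂ (out r) z z∈y
          z′ , z′∈y′ , p′ = proj₁ (out r′) u u∈x
      in subst (_∈ₜ y′) (ih u u∈x z′ z p′ p) z′∈y′

  -- The range of a bisimilarity relation is everything or a set

  module Range {_~_ : M → M → Set} (d : Definable₂ _~_)
               (out : ∀ {x y} → x ~ y → Bisimulates _~_ x y)
               (into : ∀ {x y} → Bisimulates _~_ x y → x ~ y) where

    -- An element of `u′` is pulled back to `u`, carried into `w` by `u ≼ₛ w`, and pushed forward to
    -- `w′`; the induction hypothesis compares the two ends.
    ≼-preserved : ∀ u u′ w w′ → u ~ u′ → w ~ w′ → u ≼ₛ w → u′ ≼ₜ w′
    ≼-preserved = S.∈-induction
      (all all all (atom d v3 v2 ⟶ atom d v1 v0 ⟶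
                    atom S.≼-definable v3 v1 ⟶ atom T.≼-definable v2 v0)) []
      λ u ih u′ w w′ p q u≼w → T.≼-in λ v′ v′∈u′ →
        let v , v∈u , r = proj₂ (out p) v′ v′∈u′
            z , z∈w , v≼z = S.≼-out u≼w v v∈u
            z′ , z′∈w′ , r′ = proj₁ (out q) z z∈w
        in z′ , z′∈w′ , ih v v∈u v′ z z′ r r′ v≼z

    InRange : M → Set
    InRange v = Σ M λ u → u ~ v

    RangeIsSet : Set
    RangeIsSet = Σ M λ b → ∀ v → v ∈ₜ b ⇔ InRange v

    -- Since `y` is a set for `t`, Replacement for `s` does not directly collect its preimage. The
    -- rank bound `u` does: the preimage is separated from the down-set of `u`.
    bounded-preimage⇒InRange : ∀ y u → (∀ v → v ∈ₜ y → InRange v) →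
                               (∀ a w → w ∈ₜ y → a ~ w → a ≼ₛ u) → InRange y
    bounded-preimage⇒InRange y u y⊆ below =
      let D , h = S.downSet u
          x , k = S.comprehend (ex (v0 ∈⟨ t ⟩ v2 & atom d v1 v0)) (y ∷ []) D
            λ a (w , w∈y , a~w) → from (h a) (below a w w∈y a~w)
      in x , into ((λ a → to (k a)) ,
                   λ w w∈y → let a , a~w = y⊆ w w∈y in a , from (k a) (w , w∈y , a~w) , a~w)

    -- Otherwise v has larger rank than every member of y, so the preimage of v
    -- bounds the ranks of the preimage of y.
    rank-below : ∀ y → (∀ v → v ∈ₜ y → InRange v) → ¬ InRange y →
                 ∀ v → InRange v → Σ M λ w → w ∈ₜ y × v ≼ₜ w
    rank-below y y⊆ y∉ v (u , u~v) with em {Σ M λ w → w ∈ₜ y × v ≼ₜ w}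
    ... | yes p = p
    ... | no ¬p = ⊥-elim (y∉ (bounded-preimage⇒InRange y u y⊆ below))
      where
      below : ∀ a w → w ∈ₜ y → a ~ w → a ≼ₛ u
      below a w w∈y a~w with S.≼-total a u
      ... | inj₁ a≼u = a≼u
      ... | inj₂ u≼a = ⊥-elim (¬p (w , w∈y , ≼-preserved u v a w u~v a~w u≼a))

    opaque
      -- A failing induction step is a `y` outside the range with all members inside. By
      -- `rank-below`, the down-sets of the members of `y` then cover the range, making it a set.
      surjective-or-set : (∀ y → InRange y) ⊎ RangeIsSet
      surjective-or-set with em {RangeIsSet}
      ... | yes p = inj₂ p
      ... | no ¬p = inj₁ (T.∈-induction (ex (atom d v0 v1)) [] step)
        where
        step : ∀ y → (∀ v → v ∈ₜ y → InRange v) → InRange y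
        step y y⊆ with em {InRange y}
        ... | yes q = q
        ... | no y∉ =
          let c , h = T.below-member-bound y
          in ⊥-elim (¬p (T.comprehend (ex (atom d v0 v1)) [] c λ v i →
               let w , w∈y , v≼w = rank-below y y⊆ y∉ v i in h v w w∈y v≼w))

    -- Injectivity makes the inverse of `~` functional, so Replacement for `t` collects the
    -- preimages of the range, and by totality these are everything.
    not-total : (∀ x x′ y → x ~ y → x′ ~ y → x ≡ x′) → RangeIsSet → ¬ (∀ x → Σ M λ y → x ~ y)
    not-total inj (b , h) total =
      let c , k = T.image (atom d v0 v1) [] (λ y x x′ → inj x x′ y) b
      in T.no-universal-set c λ x →
           let y , x~y = total x in k y x (from (h y) (x , x~y)) x~y

-- The bisimilarity relation and the definable isomorphism

module Isomorphism (em : ExcludedMiddle 0ℓ) (𝔐 : Structure)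
                   (zfc₁ : Structure.ZFC 𝔐 e₁) (zfc₂ : Structure.ZFC 𝔐 e₂) where
  open Structure 𝔐
  open Definability 𝔐
  module B₁₂ = Bisimulation em 𝔐 e₁ e₂ zfc₁ zfc₂
  module B₂₁ = Bisimulation em 𝔐 e₂ e₁ zfc₂ zfc₁
  open B₁₂ using (Bisimulates)
  open OneMembership em 𝔐 e₁ zfc₁
    using (Edge; edge; graph; image; transitive-superset; ∈-irreflexive)

  infix 4 _~_

  -- Both memberships live on the same domain, so an ∈₁-pair can join an element read through ∈₁ to
  -- one read through ∈₂. Quantifying over the single code `R` keeps the relation first-order.
  _~_ : M → M → Set
  x ~ y = Σ M λ R → (∀ u v → Edge R u v → Bisimulates (Edge R) u v) × Bisimulates (Edge R) x y

  opaque
    ~-definable : Definable₂ _~_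
    ~-definable = definable₂
      (ex (all all (edge v2 v1 v0 ⟶ bisim v1 v0 v2) & bisim v1 v2 v0))
      where
      bisim : ∀ {n} → Fin n → Fin n → Fin n → Fm n
      bisim x y R =
        all (v0 ∈⟨ e₁ ⟩ suc x ⟶ ex (v0 ∈⟨ e₂ ⟩ suc (suc y) & edge (suc (suc R)) v1 v0)) &
        all (v0 ∈⟨ e₂ ⟩ suc y ⟶ ex (v0 ∈⟨ e₁ ⟩ suc (suc x) & edge (suc (suc R)) v0 v1))

  ~-out : ∀ {x y} → x ~ y → Bisimulates _~_ x y
  ~-out (R , h , forth , back) =
    (λ u u∈x → let v , v∈y , g = forth u u∈x in v , v∈y , R , h , h u v g) ,
    (λ v v∈y → let u , u∈x , g = back v v∈y in u , u∈x , R , h , h u v g)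

  ~-functional : ∀ x y y′ → x ~ y → x ~ y′ → y ≡ y′
  ~-functional = B₁₂.functional ~-definable ~-out

  ~-into : ∀ {x y} → Bisimulates _~_ x y → x ~ y
  ~-into {x} {y} (forth , back) =
    let X , x⊆X , X-trans = transitive-superset x
        -- Replacement for ∈₁ is essential: y itself need not be covered by an ∈₁-set.
        Y , h = image (atom ~-definable v1 v0) [] ~-functional X
        R , e = graph ~-definable X Y
        keep : ∀ {u v} → u ∈₁ X → u ~ v → Edge R u v
        keep = λ {u} {v} u∈X u~v → from (e u v) (u∈X , h u v u∈X u~v , u~v)
    in R ,
       (λ u v g →
         let u∈X , _ , u~v = to (e u v) g
             forth′ , back′ = ~-out u~v
         in (λ a a∈u → let b , b∈v , a~b = forth′ a a∈u
                       in b , b∈v , keep (X-trans u a u∈X a∈u) a~b) ,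
            (λ b b∈v → let a , a∈u , a~b = back′ b b∈v
                       in a , a∈u , keep (X-trans u a u∈X a∈u) a~b)) ,
       (λ u u∈x → let v , v∈y , u~v = forth u u∈x in v , v∈y , keep (x⊆X u u∈x) u~v) ,
       (λ v v∈y → let u , u∈x , u~v = back v v∈y in u , u∈x , keep (x⊆X u u∈x) u~v)
    where
    _∈₁_ = R₁

  module Ran = B₁₂.Range ~-definable ~-out ~-into
  -- Although `~` is coded by ∈₁-sets, the hypotheses of `Range` are symmetric, so the inverse
  -- relation satisfies them with the memberships exchanged.
  module Dom = B₂₁.Range (flip-definable ~-definable)
                 (λ p → swap (~-out p)) (λ p → ~-into (swap p))

  ~-injective : ∀ x x′ y → x ~ y → x′ ~ y → x ≡ x′
  ~-injective x x′ y =
    B₂₁.functional (flip-definable ~-definable) (λ p → swap (~-out p)) y x x′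

  total-surjective : (∀ x → Σ M λ y → x ~ y) × (∀ y → Σ M λ x → x ~ y)
  total-surjective with Dom.surjective-or-set | Ran.surjective-or-set
  ... | inj₁ tot | inj₁ sur = tot , sur
  ... | inj₁ tot | inj₂ ran = ⊥-elim (Ran.not-total ~-injective ran tot)
  ... | inj₂ dom | inj₁ sur =
    ⊥-elim (Dom.not-total (λ y y′ x → ~-functional x y y′) dom sur)
  -- The ∈₁-set `a` is the domain and the ∈₂-set `b` the range; being bisimilar, they place `a` in
  -- its own domain.
  ... | inj₂ (a , ha) | inj₂ (b , hb) = ⊥-elim (∈-irreflexive a (from (ha a) (b , a~b)))
    where
    a~b : a ~ b
    a~b = ~-into
      ( (λ u u∈a → let v , u~v = to (ha u) u∈a in v , from (hb v) (u , u~v) , u~v)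
      , (λ v v∈b → let u , u~v = to (hb v) v∈b in u , from (ha u) (v , u~v) , u~v))

  iso : M → M
  iso x = proj₁ (proj₁ total-surjective x)

  iso-~ : ∀ x → x ~ iso x
  iso-~ x = proj₂ (proj₁ total-surjective x)

  iso-unique : ∀ {x y} → x ~ y → iso x ≡ y
  iso-unique {x} {y} p = ~-functional x (iso x) y (iso-~ x) p

  -- The flip is there because `Defines` has the value as variable 0 and the argument as variable 1.
  iso-formula : Formula 2
  iso-formula = proj₁ (flip-definable ~-definable)

  iso-defined : Defines iso-formula iso
  iso-defined x y = ⇔-trans (proj₂ (flip-definable ~-definable) (y ∷ x ∷ []))
    (mk⇔ iso-unique (λ e → subst (x ~_) e (iso-~ x)))

  iso-isIso : IsIso₁₂ iso
  iso-isIso =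
    ( (λ {x} {x′} e → ~-injective x x′ (iso x′) (subst (x ~_) e (iso-~ x)) (iso-~ x′))
    , (λ y → let x , p = proj₂ total-surjective y in x , λ { refl → iso-unique p })) ,
    λ x y → mk⇔
      (λ x∈y → let v , v∈ , x~v = proj₁ (~-out (iso-~ y)) x x∈y
               in subst (λ v → R₂ v (iso y)) (sym (iso-unique x~v)) v∈)
      (λ fx∈fy → let u , u∈y , p = proj₂ (~-out (iso-~ y)) (iso x) fx∈fy
                 in subst (λ u → R₁ u y) (~-injective u x (iso x) p (iso-~ x)) u∈y)

theorem1 : ExcludedMiddle 0ℓ → (𝔐 : Structure) →
    Structure.ZFC 𝔐 e₁ → Structure.ZFC 𝔐 e₂ →
    Σ (Formula 2) λ φ → Σ (Structure.M 𝔐 → Structure.M 𝔐) λ f →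
    Structure.Defines 𝔐 φ f × Structure.IsIso₁₂ 𝔐 f
theorem1 em 𝔐 zfc₁ zfc₂ = iso-formula , iso , iso-defined , iso-isIso
  where open Isomorphism em 𝔐 zfc₁ zfc₂
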